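{- Every conditional space $\mathfrak{X}=\langle X,\tau,T\rangle$ is isomorphic to the expanded Stone space $\langle\mathrm{Ul}(\mathrm{Clop}(\tau)),\tau_s,T_{\mathrm{Clop}(\tau)}\rangle$ of the conditional algebra $\langle\mathrm{Clop}(\tau),\to_T\rangle$, via the map $\varepsilon\colon X\to\mathrm{Ul}(\mathrm{Clop}(\tau))$, $\varepsilon(x)=\{U\in\mathrm{Clop}(\tau):x\in U\}$; that is, $\varepsilon$ is a homeomorphism and for all $x,y\in X$ and $Z\subseteq X$, $T(x,Z,y)$ iff $T_{\mathrm{Clop}(\tau)}(\varepsilon(x),\varepsilon[Z],\varepsilon(y))$.
   Context: A conditional space is a triple $\langle X,\tau,T\rangle$ where $\langle X,\tau\rangle$ is a Boolean (compact, Hausdorff, zero-dimensional) space and $T\subseteq X\times\mathcal{C}(\tau)\times X$ ($\mathcal{C}(\tau)$ the closed sets, $\mathrm{Clop}(\tau)$ the clopen sets) satisfies: (T1) for every $x$ and closed $Y$, $T(x,Y)=\{y:T(x,Y,y)\}$ is closed; (T2) for all clopen $U,V$, $U\to_T V=\{x:\text{for all closed } Z\subseteq U,\ T(x,Z)\subseteq V\}$ is clopen; (T3) for closed $Y$: $T(x,Y,y)$ iff $T(x,U,y)$ for all clopen $U\supseteq Y$. Then $\langle\mathrm{Clop}(\tau),\to_T\rangle$ is a conditional algebra. For a conditional algebra $\langle A,\to\rangle$ (Boolean algebra $A$ with $a\to1=1$, $(a\to b)\wedge(a\to c)=a\to(b\wedge c)$, $(a\vee b)\to c\le(a\to c)\wedge(b\to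 c)$): $\mathrm{Ul}(A)$ is its Stone space with topology $\tau_s$; filters include $A$ itself; $\varphi(F)=\{u:F\subseteq u\}$; $D^{\to}_u(F)=\{b:\exists a\in F,\ a\to b\in u\}$; and $T_A(u,Z,v)$ iff there is a filter $F$ with $Z=\varphi(F)$ and $D^{\to}_u(F)\subseteq v$. -}

module Defs where

open import Level using (Level) renaming (suc to lsuc)
open import Data.Bool.Base as Bool using (Bool; true; false; not)
import Data.Bool.Properties as Boolₚ
open import Data.List.Base using (List)
open import Data.List.Relation.Unary.All using (All)
open import Data.List.Relation.Unary.Any using (Any)
open import Data.Product using (Σ; Σ-syntax; _×_; _,_; proj₁; proj₂)
open import Data.Product.Relation.Binary.Pointwise.NonDependent using (_×ₛ_)
open import Data.Sum using (_⊎_; inj₁; inj₂; [_,_]′)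
open import Data.Empty using (⊥-elim)
open import Axiom.ExcludedMiddle using (ExcludedMiddle)
open import Algebra.Lattice.Bundles using (BooleanAlgebra)
open import Algebra.Lattice.Structures using (IsBooleanAlgebra)
import Relation.Binary.Construct.NaturalOrder.Left as NaturalOrder
import Relation.Binary.Construct.On as On
open import Function.Base using (_∘_; const)
open import Function.Bundles using (Func; _⟶ₛ_; _⟨$⟩_; _⇔_; mk⇔)
open import Function.Definitions using (Inverseᵇ)
import Function.Construct.Composition as Composition
open import Function.Relation.Binary.Setoid.Equality using (_⇨_)
open import Relation.Binary.Bundles using (Setoid)
open import Relation.Binary.Definitions using (_Respects_)
open import Relation.Unary using (Pred)
open import Relation.Nullary using (¬_; does; yes; no)
open import Relation.Nullary.Decidable using (does-⇔; dec-true)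
open import Relation.Binary.PropositionalEquality using (_≡_; refl; sym; trans; cong; cong₂)
import Relation.Binary.PropositionalEquality as ≡

-- A set is a setoid and its power set is the setoid of characteristic
-- functions.  Under excluded middle these are all the subsets: every
-- predicate that respects the equality has a characteristic function (see
-- `⟪_⟫` below).  Using Bool rather than Set keeps a setoid, its power set
-- and its Stone-type constructions in one universe.
module _ {ℓ : Level} where

  ∣_∣ : Setoid ℓ ℓ → Set ℓ
  ∣ X ∣ = Setoid.Carrier X

  𝒫 : Setoid ℓ ℓ → Setoid ℓ ℓ
  𝒫 X = X ⇨ ≡.setoid Bool

  Subset : Setoid ℓ ℓ → Set ℓ
  Subset X = ∣ 𝒫 X ∣

  module _ {X : Setoid ℓ ℓ} where

    infix 4 _∈_ _∉_ _⊆_ _≐_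
    infixr 7 _∩_
    infixr 6 _∪_

    _∈_ _∉_ : ∣ X ∣ → Subset X → Set
    x ∈ U = U ⟨$⟩ x ≡ true
    x ∉ U = ¬ (x ∈ U)

    _⊆_ _≐_ : Subset X → Subset X → Set ℓ
    U ⊆ V = ∀ x → x ∈ U → x ∈ V
    U ≐ V = Setoid._≈_ (𝒫 X) U V

    ∅ full : Subset X
    ∅    = record { to = const false ; cong = const refl }
    full = record { to = const true  ; cong = const refl }

    _∩_ _∪_ : Subset X → Subset X → Subset X
    U ∩ V = record
      { to   = λ x → (U ⟨$⟩ x) Bool.∧ (V ⟨$⟩ x)
      ; cong = λ e → cong₂ Bool._∧_ (Func.cong U e) (Func.cong V e) }
    U ∪ V = record
      { to   = λ x → (U ⟨$⟩ x) Bool.∨ (V ⟨$⟩ x)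
      ; cong = λ e → cong₂ Bool._∨_ (Func.cong U e) (Func.cong V e) }

    ∁ : Subset X → Subset X
    ∁ U = record
      { to   = λ x → not (U ⟨$⟩ x)
      ; cong = λ e → cong not (Func.cong U e) }

    ∈-resp-≈ : (U : Subset X) → (_∈ U) Respects (Setoid._≈_ X)
    ∈-resp-≈ U e x∈U = trans (sym (Func.cong U e)) x∈U

    ∈-resp-≐ : ∀ {x} {U V : Subset X} → U ≐ V → x ∈ U → x ∈ V
    ∈-resp-≐ {x} e x∈U = trans (sym (e x)) x∈U

    ⊆-antisym : {U V : Subset X} → U ⊆ V → V ⊆ U → U ≐ V
    ⊆-antisym U⊆V V⊆U x = Boolₚ.⇔→≡ {z = true} (mk⇔ (U⊆V x) (V⊆U x))

    ∩-intro : ∀ {x} {U V : Subset X} → x ∈ U → x ∈ V → x ∈ U ∩ V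
    ∩-intro = cong₂ Bool._∧_

    ∩-elim : ∀ {x} (U V : Subset X) → x ∈ U ∩ V → x ∈ U × x ∈ V
    ∩-elim {x} U V p with U ⟨$⟩ x | V ⟨$⟩ x
    ... | true | true = refl , refl

    ∪-elim : ∀ {x} (U V : Subset X) → x ∈ U ∪ V → x ∈ U ⊎ x ∈ V
    ∪-elim {x} U V p with U ⟨$⟩ x
    ... | true  = inj₁ refl
    ... | false = inj₂ p

    ∪-introˡ : ∀ {x} (U V : Subset X) → x ∈ U → x ∈ U ∪ V
    ∪-introˡ {x} U V p rewrite p = refl

    ∪-introʳ : ∀ {x} (U V : Subset X) → x ∈ V → x ∈ U ∪ V
    ∪-introʳ {x} U V p rewrite p = Boolₚ.∨-zeroʳ (U ⟨$⟩ x)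

  preimage : {X Y : Setoid ℓ ℓ} → X ⟶ₛ Y → Subset Y → Subset X
  preimage f V = Composition.function f V

module Classical {ℓ : Level} (em : ExcludedMiddle ℓ) where

  module _ {X : Setoid ℓ ℓ} where

    open Setoid X using (_≈_) renaming (sym to ≈-sym)

    Extensional : Pred ∣ X ∣ ℓ → Set ℓ
    Extensional P = ∀ x y → x ≈ y → P x → P y

    ⟪_⟫ : (P : Pred ∣ X ∣ ℓ) → Extensional P → Subset X
    ⟪ P ⟫ resp = record
      { to   = λ x → does (em {P x})
      ; cong = λ {x} {y} e → does-⇔ (mk⇔ (resp x y e) (resp y x (≈-sym e))) em em }

    ∈-intro : ∀ (P : Pred ∣ X ∣ ℓ) (r : Extensional P) {x} → P x → x ∈ ⟪ P ⟫ r
    ∈-intro P r = dec-true em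

    ∈-elim : ∀ (P : Pred ∣ X ∣ ℓ) (r : Extensional P) {x} → x ∈ ⟪ P ⟫ r → P x
    ∈-elim P r {x} x∈P with em {P x}
    ... | yes p = p

    private
      InUnion : Subset (𝒫 X) → Pred ∣ X ∣ ℓ
      InUnion 𝓕 x = Σ[ U ∈ Subset X ] U ∈ 𝓕 × x ∈ U

      InUnion-resp : ∀ 𝓕 → Extensional (InUnion 𝓕)
      InUnion-resp 𝓕 x y e (U , U∈𝓕 , x∈U) = U , U∈𝓕 , ∈-resp-≈ U e x∈U

    ⋃ : Subset (𝒫 X) → Subset X
    ⋃ 𝓕 = ⟪ InUnion 𝓕 ⟫ (InUnion-resp 𝓕)

    ⋃-intro : ∀ 𝓕 {x} U → U ∈ 𝓕 → x ∈ U → x ∈ ⋃ 𝓕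
    ⋃-intro 𝓕 U U∈𝓕 x∈U = ∈-intro (InUnion 𝓕) (InUnion-resp 𝓕) (U , U∈𝓕 , x∈U)

    ⋃-elim : ∀ 𝓕 {x} → x ∈ ⋃ 𝓕 → Σ[ U ∈ Subset X ] U ∈ 𝓕 × x ∈ U
    ⋃-elim 𝓕 = ∈-elim (InUnion 𝓕) (InUnion-resp 𝓕)

  image : {X Y : Setoid ℓ ℓ} → X ⟶ₛ Y → Subset X → Subset Y
  image {X} {Y} f Z = ⟪ (λ y → Σ[ x ∈ ∣ X ∣ ] x ∈ Z × Setoid._≈_ Y (f ⟨$⟩ x) y) ⟫
    (λ { _ _ e (x , x∈Z , fx≈y) → x , x∈Z , Setoid.trans Y fx≈y e })

  record TopologicalSpace : Set (lsuc ℓ) where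
    field
      points    : Setoid ℓ ℓ
      opens     : Subset (𝒫 points)
      ∅-open    : ∅ ∈ opens
      full-open : full ∈ opens
      ∩-open    : ∀ U V → U ∈ opens → V ∈ opens → U ∩ V ∈ opens
      ⋃-open    : ∀ 𝓕 → 𝓕 ⊆ opens → ⋃ 𝓕 ∈ opens

    open Setoid points public using (_≈_; _≉_)

    Point : Set ℓ
    Point = ∣ points ∣

    IsOpen IsClosed IsClopen : Subset points → Set
    IsOpen   U = U ∈ opens
    IsClosed U = IsOpen (∁ U)
    IsClopen U = IsOpen U × IsClosed U

    open-resp-≐ : ∀ {U V} → U ≐ V → IsOpen U → IsOpen V
    open-resp-≐ {U} {V} e = ∈-resp-≈ opens {U} {V} e

    ∪-open : ∀ {U V} → IsOpen U → IsOpen V → IsOpen (U ∪ V)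
    ∪-open {U} {V} U-open V-open =
      open-resp-≐ {⋃ 𝓕} {U ∪ V} (⊆-antisym {U = ⋃ 𝓕} {U ∪ V} to from)
        (⋃-open 𝓕 λ W → [ (λ e → open-resp-≐ {U} {W} (sym ∘ e) U-open)
                           , (λ e → open-resp-≐ {V} {W} (sym ∘ e) V-open) ]′
                           ∘ ∈-elim {X = 𝒫 points} P P-resp {W})
      where
      P : Pred (Subset points) ℓ
      P W = W ≐ U ⊎ W ≐ V
      P-resp : Extensional {X = 𝒫 points} P
      P-resp W W′ W≐W′ (inj₁ e) = inj₁ (λ x → trans (sym (W≐W′ x)) (e x))
      P-resp W W′ W≐W′ (inj₂ e) = inj₂ (λ x → trans (sym (W≐W′ x)) (e x))
      𝓕 : Subset (𝒫 points)
      𝓕 = ⟪_⟫ {X = 𝒫 points} P P-resp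
      to : ⋃ 𝓕 ⊆ U ∪ V
      to x x∈⋃ with ⋃-elim 𝓕 x∈⋃
      ... | W , W∈𝓕 , x∈W with ∈-elim {X = 𝒫 points} P P-resp {W} W∈𝓕
      ... | inj₁ e = ∪-introˡ U V (∈-resp-≐ {U = W} {U} e x∈W)
      ... | inj₂ e = ∪-introʳ U V (∈-resp-≐ {U = W} {V} e x∈W)
      from : U ∪ V ⊆ ⋃ 𝓕
      from x x∈∪ with ∪-elim U V x∈∪
      ... | inj₁ x∈U = ⋃-intro 𝓕 U (∈-intro {X = 𝒫 points} P P-resp {U} (inj₁ λ _ → refl)) x∈U
      ... | inj₂ x∈V = ⋃-intro 𝓕 V (∈-intro {X = 𝒫 points} P P-resp {V} (inj₂ λ _ → refl)) x∈V

    IsCompact IsHausdorff IsZeroDimensional : Set ℓ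
    IsCompact =
      (𝓕 : Subset (𝒫 points)) → 𝓕 ⊆ opens → full ⊆ ⋃ 𝓕 →
      Σ[ Us ∈ List (Subset points) ] All (_∈ 𝓕) Us × (∀ x → Any (x ∈_) Us)
    IsHausdorff =
      ∀ x y → x ≉ y →
      Σ[ U ∈ Subset points ] Σ[ V ∈ Subset points ]
        IsOpen U × IsOpen V × x ∈ U × y ∈ V × U ∩ V ≐ ∅
    IsZeroDimensional =
      ∀ x O → IsOpen O → x ∈ O →
      Σ[ U ∈ Subset points ] IsClopen U × x ∈ U × U ⊆ O

    record IsBooleanSpace : Set ℓ where
      field
        compact         : IsCompact
        hausdorff       : IsHausdorff
        zeroDimensional : IsZeroDimensional

  module _ (𝕏 𝕐 : TopologicalSpace) where
    private
      module X = TopologicalSpace 𝕏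
      module Y = TopologicalSpace 𝕐

    IsContinuous : X.points ⟶ₛ Y.points → Set ℓ
    IsContinuous f = ∀ V → Y.IsOpen V → X.IsOpen (preimage f V)

  module _ (𝕏 𝕐 : TopologicalSpace) where
    private
      module X = TopologicalSpace 𝕏
      module Y = TopologicalSpace 𝕐

    IsHomeomorphism : X.points ⟶ₛ Y.points → Set ℓ
    IsHomeomorphism f =
      Σ[ g ∈ Y.points ⟶ₛ X.points ]
        Inverseᵇ X._≈_ Y._≈_ (f ⟨$⟩_) (g ⟨$⟩_) × IsContinuous 𝕏 𝕐 f × IsContinuous 𝕐 𝕏 g

  record ConditionalAlgebra : Set (lsuc ℓ) where
    field
      booleanAlgebra : BooleanAlgebra ℓ ℓ

    open BooleanAlgebra booleanAlgebra public
      using (Carrier; _≈_; _∨_; _∧_; ⊤; ⊥; setoid)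
    open NaturalOrder _≈_ _∧_ public using (_≤_)

    infixr 5 _⇒_
    field
      _⇒_        : Carrier → Carrier → Carrier
      ⇒-cong     : ∀ {a a′ b b′} → a ≈ a′ → b ≈ b′ → (a ⇒ b) ≈ (a′ ⇒ b′)
      ⇒-⊤        : ∀ a → (a ⇒ ⊤) ≈ ⊤
      ⇒-∧        : ∀ a b c → ((a ⇒ b) ∧ (a ⇒ c)) ≈ (a ⇒ (b ∧ c))
      ∨-⇒        : ∀ a b c → ((a ∨ b) ⇒ c) ≤ ((a ⇒ c) ∧ (b ⇒ c))

  module ExpandedStone (𝔸 : ConditionalAlgebra) where
    open ConditionalAlgebra 𝔸

    -- Not required to be proper: the whole algebra is a filter.
    record IsFilter (F : Subset setoid) : Set ℓ where
      field
        ⊤∈       : ⊤ ∈ F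
        ∧-closed : ∀ {a b} → a ∈ F → b ∈ F → a ∧ b ∈ F
        ↑-closed : ∀ {a b} → a ≤ b → a ∈ F → b ∈ F

    record IsUltrafilter (u : Subset setoid) : Set ℓ where
      field
        isFilter : IsFilter u
        proper   : ⊥ ∉ u
        maximal  : ∀ G → IsFilter G → ⊥ ∉ G → u ⊆ G → G ⊆ u

      open IsFilter isFilter public

    Ul : Setoid ℓ ℓ
    Ul = On.setoid {B = Σ (Subset setoid) IsUltrafilter} (𝒫 setoid) proj₁

    σ : Carrier → Subset Ul
    σ a = record { to = λ u → proj₁ u ⟨$⟩ a ; cong = λ e → e a }

    StoneOpen : Pred (Subset Ul) ℓ
    StoneOpen O = ∀ u → u ∈ O → Σ[ a ∈ Carrier ] u ∈ σ a × σ a ⊆ O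

    StoneOpen-resp : Extensional {X = 𝒫 Ul} StoneOpen
    StoneOpen-resp O O′ e O-open u u∈O′
      with O-open u (∈-resp-≐ {X = Ul} {u} {O′} {O} (sym ∘ e) u∈O′)
    ... | a , u∈σa , σa⊆O = a , u∈σa , λ v v∈σa → ∈-resp-≐ {X = Ul} {v} {O} {O′} e (σa⊆O v v∈σa)

    -- The topology with the sets σ a as a basis.
    τₛ : Subset (𝒫 Ul)
    τₛ = ⟪_⟫ {X = 𝒫 Ul} StoneOpen StoneOpen-resp

    τₛ-intro : ∀ O → StoneOpen O → O ∈ τₛ
    τₛ-intro O = ∈-intro {X = 𝒫 Ul} StoneOpen StoneOpen-resp {O}

    τₛ-elim : ∀ O → O ∈ τₛ → StoneOpen O
    τₛ-elim O = ∈-elim {X = 𝒫 Ul} StoneOpen StoneOpen-resp {O}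

    private
      σ-∧ : ∀ a b → σ (a ∧ b) ⊆ σ a × σ (a ∧ b) ⊆ σ b
      σ-∧ a b = (λ u → IsUltrafilter.↑-closed (proj₂ u) lower₁)
              , (λ u → IsUltrafilter.↑-closed (proj₂ u) lower₂)
        where
        open BooleanAlgebra booleanAlgebra using (∧-assoc; ∧-comm; ∧-cong)
          renaming (sym to ≈-sym; trans to ≈-trans; refl to ≈-refl)
        open import Algebra.Lattice.Properties.BooleanAlgebra booleanAlgebra using (∧-idem)
        lower₂ : (a ∧ b) ≤ b
        lower₂ = ≈-sym (≈-trans (∧-assoc a b b) (∧-cong ≈-refl (∧-idem b)))
        lower₁ : (a ∧ b) ≤ a
        lower₁ = ≈-sym (≈-trans (∧-cong (∧-comm a b) ≈-refl)
                 (≈-trans (∧-assoc b a a) (≈-trans (∧-cong ≈-refl (∧-idem a)) (∧-comm b a))))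

    stoneSpace : TopologicalSpace
    stoneSpace = record
      { points    = Ul
      ; opens     = τₛ
      ; ∅-open    = τₛ-intro ∅ λ _ ()
      ; full-open = τₛ-intro full λ u _ → ⊤ , IsUltrafilter.⊤∈ (proj₂ u) , λ _ _ → refl
      ; ∩-open    = ∩-case
      ; ⋃-open    = ⋃-case
      }
      where
      ∩-case : ∀ U V → U ∈ τₛ → V ∈ τₛ → U ∩ V ∈ τₛ
      ∩-case U V U-open V-open = τₛ-intro (U ∩ V) helper
        where
        helper : StoneOpen (U ∩ V)
        helper u u∈ with ∩-elim {X = Ul} {u} U V u∈
        ... | u∈U , u∈V with τₛ-elim U U-open u u∈U | τₛ-elim V V-open u u∈V
        ... | a , u∈σa , σa⊆U | b , u∈σb , σb⊆V =
          a ∧ b , IsUltrafilter.∧-closed (proj₂ u) u∈σa u∈σb ,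
          λ v v∈ → ∩-intro {X = Ul} {v} {U} {V} (σa⊆U v (proj₁ (σ-∧ a b) v v∈)) (σb⊆V v (proj₂ (σ-∧ a b) v v∈))
      ⋃-case : ∀ 𝓕 → 𝓕 ⊆ τₛ → ⋃ 𝓕 ∈ τₛ
      ⋃-case 𝓕 𝓕⊆ = τₛ-intro (⋃ 𝓕) helper
        where
        helper : StoneOpen (⋃ 𝓕)
        helper u u∈ with ⋃-elim 𝓕 {u} u∈
        ... | O , O∈𝓕 , u∈O with τₛ-elim O (𝓕⊆ O O∈𝓕) u u∈O
        ... | a , u∈σa , σa⊆O =
          a , u∈σa , λ v v∈σa → ⋃-intro 𝓕 {v} O O∈𝓕 (σa⊆O v v∈σa)

    φ : Subset setoid → Subset Ul
    φ F = ⟪ (λ u → F ⊆ proj₁ u) ⟫ (λ _ _ e F⊆u a a∈F → trans (sym (e a)) (F⊆u a a∈F))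

    D : ∣ Ul ∣ → Subset setoid → Subset setoid
    D u F = ⟪ (λ b → Σ[ a ∈ Carrier ] a ∈ F × (a ⇒ b) ∈ proj₁ u) ⟫
      (λ { _ _ e (a , a∈F , a⇒b∈u) →
           a , a∈F , ∈-resp-≈ (proj₁ u) (⇒-cong (BooleanAlgebra.refl booleanAlgebra) e) a⇒b∈u })

    T : ∣ Ul ∣ → Subset Ul → ∣ Ul ∣ → Set ℓ
    T u Z v = Σ[ F ∈ Subset setoid ] IsFilter F × Z ≐ φ F × D u F ⊆ proj₁ v

  record ConditionalSpace : Set (lsuc ℓ) where
    field
      space          : TopologicalSpace
    open TopologicalSpace space public
    field
      isBooleanSpace : IsBooleanSpace

      -- T ⊆ X × 𝒞(τ) × X, given as a subset of X × 𝒫 X × X that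
      -- satisfies T-closed below; so T x Z y makes sense for every Z ⊆ X.
      graph          : Subset (points ×ₛ (𝒫 points ×ₛ points))

    T : Point → Subset points → Point → Set
    T x Y y = (x , Y , y) ∈ graph

    T[_,_] : Point → Subset points → Subset points
    T[ x , Y ] = record
      { to   = λ y → graph ⟨$⟩ (x , Y , y)
      ; cong = λ e → Func.cong graph (Setoid.refl points , (λ _ → refl) , e) }

    private
      Arrow : Subset points → Subset points → Pred Point ℓ
      Arrow U V x = ∀ Z → IsClosed Z → Z ⊆ U → T[ x , Z ] ⊆ V

      Arrow-resp : ∀ U V → Extensional {X = points} (Arrow U V)
      Arrow-resp U V x x′ e p Z Z-closed Z⊆U y Ty = p Z Z-closed Z⊆U y
        (trans (Func.cong graph (e , (λ _ → refl) , Setoid.refl points)) Ty)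

    infixr 5 _→T_
    _→T_ : Subset points → Subset points → Subset points
    U →T V = ⟪_⟫ {X = points} (Arrow U V) (Arrow-resp U V)

    →T-intro : ∀ {x} U V → (∀ Z → IsClosed Z → Z ⊆ U → T[ x , Z ] ⊆ V) → x ∈ U →T V
    →T-intro {x} U V = ∈-intro {X = points} (Arrow U V) (Arrow-resp U V) {x}

    →T-elim : ∀ {x} U V → x ∈ U →T V → ∀ Z → IsClosed Z → Z ⊆ U → T[ x , Z ] ⊆ V
    →T-elim {x} U V = ∈-elim {X = points} (Arrow U V) (Arrow-resp U V) {x}

    field
      T-closed : ∀ x Y y → T x Y y → IsClosed Y
      T1 : ∀ x Y → IsClosed Y → IsClosed T[ x , Y ]
      T2 : ∀ U V → IsClopen U → IsClopen V → IsClopen (U →T V)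
      T3 : ∀ x Y y → IsClosed Y → T x Y y ⇔ (∀ U → IsClopen U → Y ⊆ U → T x U y)

  module ClopenAlgebra (𝔛 : ConditionalSpace) where
    open ConditionalSpace 𝔛

    Clop : Setoid ℓ ℓ
    Clop = On.setoid {B = Σ (Subset points) IsClopen} (𝒫 points) proj₁

    private
      module B = IsBooleanAlgebra Boolₚ.∨-∧-isBooleanAlgebra

      infixr 7 _∧_
      infixr 6 _∨_
      _∧_ _∨_ : ∣ Clop ∣ → ∣ Clop ∣ → ∣ Clop ∣
      (U , U-open , U-closed) ∧ (V , V-open , V-closed) =
        U ∩ V , ∩-open U V U-open V-open
        , open-resp-≐ {∁ U ∪ ∁ V} {∁ (U ∩ V)}
            (λ x → sym (deMorgan (U ⟨$⟩ x) (V ⟨$⟩ x))) (∪-open {∁ U} {∁ V} U-closed V-closed)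
        where
        deMorgan : ∀ a b → not (a Bool.∧ b) ≡ not a Bool.∨ not b
        deMorgan true  b = refl
        deMorgan false b = refl
      (U , U-open , U-closed) ∨ (V , V-open , V-closed) =
        U ∪ V , ∪-open {U} {V} U-open V-open
        , open-resp-≐ {∁ U ∩ ∁ V} {∁ (U ∪ V)}
            (λ x → sym (deMorgan (U ⟨$⟩ x) (V ⟨$⟩ x))) (∩-open (∁ U) (∁ V) U-closed V-closed)
        where
        deMorgan : ∀ a b → not (a Bool.∨ b) ≡ not a Bool.∧ not b
        deMorgan true  b = refl
        deMorgan false b = refl

      neg : ∣ Clop ∣ → ∣ Clop ∣
      neg (U , U-open , U-closed) =
        ∁ U , U-closed
        , open-resp-≐ {U} {∁ (∁ U)} (λ x → sym (Boolₚ.not-involutive (U ⟨$⟩ x))) U-open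

      ⊤ ⊥ : ∣ Clop ∣
      ⊤ = full , full-open , open-resp-≐ {∅} {∁ full} (λ _ → refl) ∅-open
      ⊥ = ∅ , ∅-open , open-resp-≐ {full} {∁ ∅} (λ _ → refl) full-open

      _⇒_ : ∣ Clop ∣ → ∣ Clop ∣ → ∣ Clop ∣
      (U , U-clopen) ⇒ (V , V-clopen) = U →T V , T2 U V U-clopen V-clopen

      val : Point → ∣ Clop ∣ → Bool
      val x (U , _) = U ⟨$⟩ x

    clopBooleanAlgebra : BooleanAlgebra ℓ ℓ
    clopBooleanAlgebra = record
      { Carrier = ∣ Clop ∣
      ; _≈_ = Setoid._≈_ Clop
      ; _∨_ = _∨_
      ; _∧_ = _∧_
      ; ¬_ = neg
      ; ⊤ = ⊤
      ; ⊥ = ⊥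
      ; isBooleanAlgebra = record
        { isDistributiveLattice = record
          { isLattice = record
            { isEquivalence = Setoid.isEquivalence Clop
            ; ∨-comm  = λ U V x → B.∨-comm (val x U) (val x V)
            ; ∨-assoc = λ U V W x → B.∨-assoc (val x U) (val x V) (val x W)
            ; ∨-cong  = λ p q x → cong₂ Bool._∨_ (p x) (q x)
            ; ∧-comm  = λ U V x → B.∧-comm (val x U) (val x V)
            ; ∧-assoc = λ U V W x → B.∧-assoc (val x U) (val x V) (val x W)
            ; ∧-cong  = λ p q x → cong₂ Bool._∧_ (p x) (q x)
            ; absorptive = (λ U V x → B.∨-absorbs-∧ (val x U) (val x V))
                         , (λ U V x → B.∧-absorbs-∨ (val x U) (val x V))
            }
          ; ∨-distrib-∧ = (λ U V W x → B.∨-distribˡ-∧ (val x U) (val x V) (val x W))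
                        , (λ U V W x → B.∨-distribʳ-∧ (val x U) (val x V) (val x W))
          ; ∧-distrib-∨ = (λ U V W x → B.∧-distribˡ-∨ (val x U) (val x V) (val x W))
                        , (λ U V W x → B.∧-distribʳ-∨ (val x U) (val x V) (val x W))
          }
        ; ∨-complement = (λ U x → B.∨-complementˡ (val x U)) , (λ U x → B.∨-complementʳ (val x U))
        ; ∧-complement = (λ U x → B.∧-complementˡ (val x U)) , (λ U x → B.∧-complementʳ (val x U))
        ; ¬-cong = λ p x → cong not (p x)
        }
      }

    private
      →T-mono : ∀ U U′ V V′ → U′ ⊆ U → V ⊆ V′ → U →T V ⊆ U′ →T V′
      →T-mono U U′ V V′ U′⊆U V⊆V′ x p = →T-intro U′ V′ λ Z Z-closed Z⊆U′ y Ty →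
        V⊆V′ y (→T-elim U V p Z Z-closed (λ z → U′⊆U z ∘ Z⊆U′ z) y Ty)

      ≐⇒⊆ : ∀ {U V : Subset points} → U ≐ V → U ⊆ V
      ≐⇒⊆ e x x∈U = trans (sym (e x)) x∈U

    clopConditionalAlgebra : ConditionalAlgebra
    clopConditionalAlgebra = record
      { booleanAlgebra = clopBooleanAlgebra
      ; _⇒_    = _⇒_
      ; ⇒-cong = λ { {U , _} {U′ , _} {V , _} {V′ , _} p q →
          ⊆-antisym {U = U →T V} {U′ →T V′}
            (→T-mono U U′ V V′ (≐⇒⊆ {U′} {U} (sym ∘ p)) (≐⇒⊆ {V} {V′} q))
            (→T-mono U′ U V′ V (≐⇒⊆ {U} {U′} p) (≐⇒⊆ {V′} {V} (sym ∘ q))) }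
      ; ⇒-⊤    = λ { (U , _) x → →T-intro U full (λ _ _ _ _ _ → refl) }
      ; ⇒-∧    = λ { (U , _) (V , _) (W , _) →
          ⊆-antisym {U = (U →T V) ∩ (U →T W)} {U →T V ∩ W}
            (λ x p → let (p₁ , p₂) = ∩-elim (U →T V) (U →T W) p in
              →T-intro U (V ∩ W) λ Z Z-closed Z⊆U y Ty →
                ∩-intro {U = V} {W} (→T-elim U V p₁ Z Z-closed Z⊆U y Ty)
                                    (→T-elim U W p₂ Z Z-closed Z⊆U y Ty))
            (λ x p → ∩-intro {U = U →T V} {U →T W}
              (→T-mono U U (V ∩ W) V (λ _ q → q) (λ y → proj₁ ∘ ∩-elim V W) x p)
              (→T-mono U U (V ∩ W) W (λ _ q → q) (λ y → proj₂ ∘ ∩-elim V W) x p)) }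
      ; ∨-⇒    = λ { (U , _) (V , _) (W , _) →
          ⊆-antisym {U = U ∪ V →T W} {(U ∪ V →T W) ∩ ((U →T W) ∩ (V →T W))}
            (λ x p → ∩-intro {U = U ∪ V →T W} {(U →T W) ∩ (V →T W)} p
              (∩-intro {U = U →T W} {V →T W}
                (→T-mono (U ∪ V) U W W (λ y → ∪-introˡ U V) (λ _ q → q) x p)
                (→T-mono (U ∪ V) V W W (λ y → ∪-introʳ U V) (λ _ q → q) x p)))
            (λ x p → proj₁ (∩-elim (U ∪ V →T W) ((U →T W) ∩ (V →T W)) p)) }
      }

    open ExpandedStone clopConditionalAlgebra public
      using (Ul; stoneSpace; IsFilter; IsUltrafilter)
      renaming (T to T-Clop)

    ε : points ⟶ₛ Ul
    ε = record
      { to   = λ x → ε₀ x , isUltrafilter x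
      ; cong = λ e U → Func.cong (proj₁ U) e }
      where
      ε₀ : Point → Subset Clop
      ε₀ x = record { to = λ U → proj₁ U ⟨$⟩ x ; cong = λ e → e x }

      isUltrafilter : ∀ x → IsUltrafilter (ε₀ x)
      isUltrafilter x = record
        { isFilter = record
          { ⊤∈       = refl
          ; ∧-closed = λ { {U , _} {V , _} → ∩-intro {U = U} {V} }
          ; ↑-closed = λ { {U , _} {V , _} U≤V x∈U →
              proj₂ (∩-elim U V (∈-resp-≐ {U = U} {U ∩ V} U≤V x∈U)) }
          }
        ; proper  = λ ()
        ; maximal = λ G G-filter ⊥∉G ε⊆G U U∈G → maximal G G-filter ⊥∉G ε⊆G U U∈G (val x U) refl
        }
        where
        maximal : ∀ G → IsFilter G → ⊥ ∉ G → ε₀ x ⊆ G →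
                  ∀ U → U ∈ G → ∀ b → val x U ≡ b → U ∈ ε₀ x
        maximal G G-filter ⊥∉G ε⊆G U U∈G true  x∈U = x∈U
        maximal G G-filter ⊥∉G ε⊆G U U∈G false x∉U = ⊥-elim (⊥∉G
          (∈-resp-≈ G {U ∧ neg U} {⊥} (λ z → B.∧-complementʳ (val z U))
            (IsFilter.∧-closed G-filter {U} {neg U} U∈G (ε⊆G (neg U) (cong not x∉U)))))

{-# OPTIONS --safe #-}
-- The key point is compactness in the form: a clopen set that contains the
-- intersection of a filter F of clopen sets belongs to F.  For the clopen set ∅
-- it makes ε surjective; injectivity and the two continuity claims come from
-- the clopen basis.  If T(x,Z,y), the filter of clopen supersets of Z witnesses
-- T_Clop(ε x, ε[Z], ε y).  Conversely, if F is a witness then Z = ⋂F, so by T3 it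
-- suffices to show T(x,U,y) for U ∈ F.  Otherwise a clopen V separates the
-- closed set T(x,U) from y; since T(x,–) is monotone, x ∈ U →T V, so y ∈ V, a
-- contradiction.
module Submission where

open import Defs
open import Algebra.Lattice.Bundles using (BooleanAlgebra)
open import Axiom.ExcludedMiddle using (ExcludedMiddle)
open import Data.Bool.Base using (true; not)
open import Data.Bool.Properties using (¬-not; not-involutive)
open import Data.Empty using (⊥-elim)
open import Data.List.Base using ([]; _∷_)
open import Data.List.Relation.Unary.All using (All; []; _∷_)
open import Data.List.Relation.Unary.Any using (Any; here; there)
open import Data.Product using (Σ-syntax; _×_; _,_; proj₁; proj₂)
open import Data.Sum using (_⊎_; inj₁; inj₂)
open import Function.Bundles using (Func; _⟶ₛ_; _⟨$⟩_; _⇔_; mk⇔; module Equivalence)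
open import Function.Definitions using (Inverseᵇ)
open import Relation.Binary.Bundles using (Setoid)
open import Relation.Binary.PropositionalEquality using (_≡_; refl; sym; trans; cong)
open import Relation.Nullary using (¬_; does; yes; no)
open import Relation.Nullary.Decidable using (dec-true)
open import Relation.Unary using (Pred)

-- Complements, membership and open sets

module _ {ℓ} {X : Setoid ℓ ℓ} where

  ∉⇒∈∁ : ∀ {x} (U : Subset X) → x ∉ U → x ∈ ∁ U
  ∉⇒∈∁ U x∉U = cong not (¬-not x∉U)

  ∈∁⇒∉ : ∀ {x} (U : Subset X) → x ∈ ∁ U → x ∉ U
  ∈∁⇒∉ U x∈∁U x∈U with trans (sym x∈∁U) (cong not x∈U)
  ... | ()

  ∉∁⇒∈ : ∀ {x} (U : Subset X) → x ∉ ∁ U → x ∈ U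
  ∉∁⇒∈ {x} U x∉∁U = trans (sym (not-involutive (U ⟨$⟩ x))) (∉⇒∈∁ (∁ U) x∉∁U)

module _ {ℓ} (em : ExcludedMiddle ℓ) where
  open Classical em

  -- An `∈-elim` that leaves the predicate to unification; with `dec-true em` it serves `image`, `φ`
  -- and `D`, whose predicates are anonymous.
  does⇒holds : {P : Set ℓ} → does (em {P}) ≡ true → P
  does⇒holds {P} d with em {P}
  ... | yes p = p

  module _ (𝕏 : TopologicalSpace) where
    open TopologicalSpace 𝕏

    locallyOpen⇒open : ∀ O →
      (∀ x → x ∈ O → Σ[ U ∈ Subset points ] IsOpen U × x ∈ U × U ⊆ O) → IsOpen O
    locallyOpen⇒open O nbhd =
      open-resp-≐ {⋃ 𝓕} {O} (⊆-antisym {U = ⋃ 𝓕} {O} ⋃⊆O O⊆⋃)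
        (⋃-open 𝓕 λ W W∈𝓕 → proj₁ (∈-elim {X = 𝒫 points} P P-resp {W} W∈𝓕))
      where
      P : Pred (Subset points) ℓ
      P W = IsOpen W × W ⊆ O

      P-resp : Extensional {X = 𝒫 points} P
      P-resp W W′ e (W-open , W⊆O) =
        open-resp-≐ {W} {W′} e W-open , λ x x∈W′ → W⊆O x (trans (e x) x∈W′)

      𝓕 : Subset (𝒫 points)
      𝓕 = ⟪_⟫ {X = 𝒫 points} P P-resp

      ⋃⊆O : ⋃ 𝓕 ⊆ O
      ⋃⊆O x x∈⋃ with ⋃-elim 𝓕 x∈⋃
      ... | W , W∈𝓕 , x∈W = proj₂ (∈-elim {X = 𝒫 points} P P-resp {W} W∈𝓕) x x∈W

      O⊆⋃ : O ⊆ ⋃ 𝓕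
      O⊆⋃ x x∈O with nbhd x x∈O
      ... | W , W-open , x∈W , W⊆O =
        ⋃-intro 𝓕 W (∈-intro {X = 𝒫 points} P P-resp {W} (W-open , W⊆O)) x∈W

  module _ (𝔛 : ConditionalSpace) where
    open ConditionalSpace 𝔛
    open IsBooleanSpace isBooleanSpace
    open ClopenAlgebra 𝔛
    open ConditionalAlgebra clopConditionalAlgebra
      using (_∧_; _∨_; ⊤; ⊥; _≤_)
    open BooleanAlgebra clopBooleanAlgebra using () renaming (¬_ to neg)
    open ExpandedStone clopConditionalAlgebra
      using (φ; τₛ-intro; τₛ-elim)

    private
      ⊆⇒≤ : ∀ U V → proj₁ U ⊆ proj₁ V → U ≤ V
      ⊆⇒≤ (U , _) (V , _) U⊆V = ⊆-antisym {U = U} {U ∩ V}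
        (λ x x∈U → ∩-intro {U = U} {V} x∈U (U⊆V x x∈U))
        (λ x x∈∩ → proj₁ (∩-elim U V x∈∩))

    -- Clopen separation and compactness for filters

    clopen-separation : ∀ C y → IsClosed C → y ∉ C →
      Σ[ V ∈ ∣ Clop ∣ ] C ⊆ proj₁ V × y ∉ proj₁ V
    clopen-separation C y C-closed y∉C
      with zeroDimensional y (∁ C) C-closed (∉⇒∈∁ C y∉C)
    ... | U , U-clopen , y∈U , U⊆∁C =
      neg (U , U-clopen)
      , (λ x x∈C → ∉⇒∈∁ U λ x∈U → ∈∁⇒∉ C (U⊆∁C x x∈U) x∈C)
      , λ y∈∁U → ∈∁⇒∉ U y∈∁U y∈U

    ⋂ : Subset Clop → Pred Point ℓ
    ⋂ F x = ∀ V → V ∈ F → x ∈ proj₁ V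

    -- A point outside some `V` in `F` lies in `∁ V`, and every other point lies in `U`. So the sets
    -- `∁ V ∪ U` cover the space, and a finite subcover yields finitely many members of `F` whose
    -- meet lies below `U`.
    ⋂⊆⇒∈filter : ∀ F → IsFilter F → ∀ U → (∀ x → ⋂ F x → x ∈ proj₁ U) → U ∈ F
    ⋂⊆⇒∈filter F F-filter U ⋂F⊆U =
      let Ws , Ws∈𝓕 , cover = compact 𝓕 𝓕⊆opens full⊆⋃
          V , V∈F , V⊆U = meet Ws Ws∈𝓕
      in ↑-closed {V} {U} (⊆⇒≤ V U λ x x∈V → V⊆U x x∈V (cover x)) V∈F
      where
      open IsFilter F-filter

      -- Putting U into each member of the cover saves treating it separately.
      P : Pred (Subset points) ℓ
      P W = Σ[ V ∈ ∣ Clop ∣ ] V ∈ F × W ≐ proj₁ (neg V ∨ U)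

      P-resp : Extensional {X = 𝒫 points} P
      P-resp W W′ e (V , V∈F , W≐) = V , V∈F , λ x → trans (sym (e x)) (W≐ x)

      𝓕 : Subset (𝒫 points)
      𝓕 = ⟪_⟫ {X = 𝒫 points} P P-resp

      𝓕⊆opens : 𝓕 ⊆ opens
      𝓕⊆opens W W∈𝓕 with ∈-elim {X = 𝒫 points} P P-resp {W} W∈𝓕
      ... | V , _ , W≐ =
        open-resp-≐ {proj₁ (neg V ∨ U)} {W} (λ x → sym (W≐ x)) (proj₁ (proj₂ (neg V ∨ U)))

      member : ∀ V → V ∈ F → proj₁ (neg V ∨ U) ∈ 𝓕
      member V V∈F =
        ∈-intro {X = 𝒫 points} P P-resp {proj₁ (neg V ∨ U)} (V , V∈F , λ _ → refl)

      full⊆⋃ : full ⊆ ⋃ 𝓕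
      full⊆⋃ x _ with em {Σ[ V ∈ ∣ Clop ∣ ] V ∈ F × x ∉ proj₁ V}
      ... | yes (V , V∈F , x∉V) =
        ⋃-intro 𝓕 (proj₁ (neg V ∨ U)) (member V V∈F)
          (∪-introˡ (∁ (proj₁ V)) (proj₁ U) (∉⇒∈∁ (proj₁ V) x∉V))
      ... | no ¬∃ =
        -- `⊤` is a member of `F` that is always at hand; membership in `∁ full ∪ U` reduces to
        -- membership in `U`.
        ⋃-intro 𝓕 (proj₁ (neg ⊤ ∨ U)) (member ⊤ ⊤∈)
          (⋂F⊆U x λ V V∈F → ∉∁⇒∈ (proj₁ V) λ x∈∁V →
            ¬∃ (V , V∈F , ∈∁⇒∉ (proj₁ V) x∈∁V))

      meet : ∀ Ws → All (_∈ 𝓕) Ws →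
        Σ[ V ∈ ∣ Clop ∣ ] V ∈ F × (∀ x → x ∈ proj₁ V → Any (x ∈_) Ws → x ∈ proj₁ U)
      meet [] [] = ⊤ , ⊤∈ , λ _ _ ()
      meet (W ∷ Ws) (W∈𝓕 ∷ Ws∈𝓕)
        with ∈-elim {X = 𝒫 points} P P-resp {W} W∈𝓕 | meet Ws Ws∈𝓕
      ... | V , V∈F , W≐ | V′ , V′∈F , V′⊆U =
        V ∧ V′ , ∧-closed {V} {V′} V∈F V′∈F , λ where
          x x∈∩ (here x∈W) → case-W x x∈∩ (∪-elim (∁ (proj₁ V)) (proj₁ U) (trans (sym (W≐ x)) x∈W))
          x x∈∩ (there x∈Ws) → V′⊆U x (proj₂ (∩-elim (proj₁ V) (proj₁ V′) x∈∩)) x∈Ws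
        where
        case-W : ∀ x → x ∈ proj₁ (V ∧ V′) → x ∈ ∁ (proj₁ V) ⊎ x ∈ proj₁ U → x ∈ proj₁ U
        case-W x x∈∩ (inj₁ x∈∁V) =
          ⊥-elim (∈∁⇒∉ (proj₁ V) x∈∁V (proj₁ (∩-elim (proj₁ V) (proj₁ V′) x∈∩)))
        case-W x x∈∩ (inj₂ x∈U) = x∈U

    -- The homeomorphism

    ε-injective : ∀ x y → Setoid._≈_ Ul (ε ⟨$⟩ x) (ε ⟨$⟩ y) → x ≈ y
    ε-injective x y εx≈εy with em {x ≈ y}
    ... | yes x≈y = x≈y
    ... | no  x≉y with hausdorff x y x≉y
    ... | O , O′ , O-open , _ , x∈O , y∈O′ , O∩O′≐∅ with zeroDimensional x O O-open x∈O
    ... | U , U-clopen , x∈U , U⊆O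
      -- The clopen `U` belongs to `ε x`, hence to `ε y`, which puts `y` into both disjoint open
      -- sets.
      with trans (sym (O∩O′≐∅ y))
             (∩-intro {U = O} {O′} (U⊆O y (trans (sym (εx≈εy (U , U-clopen))) x∈U)) y∈O′)
    ... | ()

    -- Unfolded, `⋂ u x` says that `u` is contained in `ε x`, and maximality of `u` turns this into
    -- equality. If no such `x` exists, compactness puts `⊥` into `u`.
    ε-surjective : ∀ u → Σ[ x ∈ Point ] Setoid._≈_ Ul (ε ⟨$⟩ x) u
    ε-surjective (u , u-ultra) with em {Σ[ x ∈ Point ] ⋂ u x}
    ... | no  ¬∃ = ⊥-elim (IsUltrafilter.proper u-ultra
      (⋂⊆⇒∈filter u (IsUltrafilter.isFilter u-ultra) ⊥ λ x x∈⋂u → ⊥-elim (¬∃ (x , x∈⋂u))))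
    ... | yes (x , u⊆εx) = x , ⊆-antisym {U = proj₁ (ε ⟨$⟩ x)} {u}
      (IsUltrafilter.maximal u-ultra (proj₁ (ε ⟨$⟩ x)) εx.isFilter εx.proper u⊆εx) u⊆εx
      where module εx = IsUltrafilter (proj₂ (ε ⟨$⟩ x))

    ε⁻¹ : Ul ⟶ₛ points
    ε⁻¹ = record
      { to   = λ u → proj₁ (ε-surjective u)
      ; cong = λ {u} {v} u≈v → ε-injective _ _ λ U →
          trans (proj₂ (ε-surjective u) U) (trans (u≈v U) (sym (proj₂ (ε-surjective v) U))) }

    ε-inverse : Inverseᵇ _≈_ (Setoid._≈_ Ul) (ε ⟨$⟩_) (ε⁻¹ ⟨$⟩_)
    ε-inverse =
      (λ {u} {x} x≈ U → trans (Func.cong (proj₁ U) x≈) (proj₂ (ε-surjective u) U))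
      , λ {x} {u} u≈εx → ε-injective _ x λ U → trans (proj₂ (ε-surjective u) U) (u≈εx U)

    -- The preimage of the basic open set `σ U` under `ε` is `U` itself.
    ε-continuous : IsContinuous space stoneSpace ε
    ε-continuous V V-open = locallyOpen⇒open space (preimage ε V) λ x εx∈V →
      let (U , U-open , _) , x∈U , σU⊆V = τₛ-elim V V-open (ε ⟨$⟩ x) εx∈V
      in U , U-open , x∈U , λ y y∈U → σU⊆V (ε ⟨$⟩ y) y∈U

    ε⁻¹-continuous : IsContinuous stoneSpace space ε⁻¹
    ε⁻¹-continuous V V-open = τₛ-intro (preimage ε⁻¹ V) λ u x∈V →
      let U , U-clopen , x∈U , U⊆V = zeroDimensional (ε⁻¹ ⟨$⟩ u) V V-open x∈V
      in (U , U-clopen)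
         , trans (sym (proj₂ (ε-surjective u) (U , U-clopen))) x∈U
         , λ v U∈v → U⊆V _ (trans (proj₂ (ε-surjective v) (U , U-clopen)) U∈v)

    ε-homeomorphism : IsHomeomorphism space stoneSpace ε
    ε-homeomorphism = ε⁻¹ , ε-inverse , ε-continuous , ε⁻¹-continuous

    -- Preservation of the relation

    T-monotone : ∀ x y Z U → IsClopen U → Z ⊆ U → T x Z y → T x U y
    T-monotone x y Z U U-clopen Z⊆U Txzy =
      Equivalence.to (T3 x Z y (T-closed x Z y Txzy)) Txzy U U-clopen Z⊆U

    private
      Supersets : Subset points → Pred ∣ Clop ∣ ℓ
      Supersets Z U = Z ⊆ proj₁ U

      Supersets-resp : ∀ Z → Extensional {X = Clop} (Supersets Z)
      Supersets-resp Z U V U≈V Z⊆U x x∈Z = trans (sym (U≈V x)) (Z⊆U x x∈Z)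

    -- For empty `Z` this is the whole algebra, so improper filters do occur as witnesses.
    ↑ : Subset points → Subset Clop
    ↑ Z = ⟪_⟫ {X = Clop} (Supersets Z) (Supersets-resp Z)

    ↑-intro : ∀ Z U → Z ⊆ proj₁ U → U ∈ ↑ Z
    ↑-intro Z U = ∈-intro {X = Clop} (Supersets Z) (Supersets-resp Z) {U}

    ↑-elim : ∀ Z U → U ∈ ↑ Z → Z ⊆ proj₁ U
    ↑-elim Z U = ∈-elim {X = Clop} (Supersets Z) (Supersets-resp Z) {U}

    ↑-isFilter : ∀ Z → IsFilter (↑ Z)
    ↑-isFilter Z = record
      { ⊤∈       = ↑-intro Z ⊤ λ _ _ → refl
      ; ∧-closed = λ {U} {V} U∈ V∈ → ↑-intro Z (U ∧ V) λ x x∈Z →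
          ∩-intro {U = proj₁ U} {proj₁ V} (↑-elim Z U U∈ x x∈Z) (↑-elim Z V V∈ x x∈Z)
      ; ↑-closed = λ {U} {V} U≤V U∈ → ↑-intro Z V λ x x∈Z →
          proj₂ (∩-elim (proj₁ U) (proj₁ V) (trans (sym (U≤V x)) (↑-elim Z U U∈ x x∈Z)))
      }

    -- A closed set is the intersection of its clopen supersets, and by surjectivity every
    -- ultrafilter in `φ (↑ Z)` is some `ε x`.
    image≐φ↑ : ∀ Z → IsClosed Z → image ε Z ≐ φ (↑ Z)
    image≐φ↑ Z Z-closed = ⊆-antisym {X = Ul} {U = image ε Z} {φ (↑ Z)}
      (λ u u∈ε[Z] → let x , x∈Z , εx≈u = does⇒holds u∈ε[Z] in
        dec-true em λ U U∈↑Z → trans (sym (εx≈u U)) (↑-elim Z U U∈↑Z x x∈Z))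
      (λ u u∈φ → let x , εx≈u = ε-surjective u in
        dec-true em (x , ∈Z x (λ U U∈↑Z → trans (εx≈u U) (does⇒holds u∈φ U U∈↑Z)) , εx≈u))
      where
      ∈Z : ∀ x → ⋂ (↑ Z) x → x ∈ Z
      ∈Z x x∈⋂ = ∉∁⇒∈ Z λ x∈∁Z →
        let V , Z⊆V , x∉V = clopen-separation Z x Z-closed (∈∁⇒∉ Z x∈∁Z)
        in x∉V (x∈⋂ V (↑-intro Z V Z⊆V))

    T⇒T-Clop : ∀ x y Z → T x Z y → T-Clop (ε ⟨$⟩ x) (image ε Z) (ε ⟨$⟩ y)
    T⇒T-Clop x y Z Txzy = ↑ Z , ↑-isFilter Z , image≐φ↑ Z Z-closed , λ V V∈D →
      let U , U∈↑Z , x∈U⇒V = does⇒holds V∈D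
      -- `Z` is itself one of the closed subsets of `U` over which `U →T V` quantifies.
      in →T-elim (proj₁ U) (proj₁ V) x∈U⇒V Z Z-closed (↑-elim Z U U∈↑Z) y Txzy
      where
      Z-closed : IsClosed Z
      Z-closed = T-closed x Z y Txzy

    -- Reflection of the relation

    module _ (F : Subset Clop) (Z : Subset points) (ε[Z]≐φF : image ε Z ≐ φ F) where

      image≐φ⇒⊆⋂ : ∀ x → x ∈ Z → ⋂ F x
      image≐φ⇒⊆⋂ x x∈Z = does⇒holds
        (trans (sym (ε[Z]≐φF (ε ⟨$⟩ x))) (dec-true em (x , x∈Z , λ _ → refl)))

      image≐φ⇒⋂⊆ : ∀ x → ⋂ F x → x ∈ Z
      image≐φ⇒⋂⊆ x x∈⋂F =
        let z , z∈Z , εz≈εx = does⇒holds (trans (ε[Z]≐φF (ε ⟨$⟩ x)) (dec-true em x∈⋂F))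
        in ∈-resp-≈ Z (ε-injective z x εz≈εx) z∈Z

      -- `Z` equals the intersection of the clopen sets in `F`. T3 asks for closedness, while `Z` is
      -- arbitrary in the theorem.
      image≐φ⇒closed : IsClosed Z
      image≐φ⇒closed = locallyOpen⇒open space (∁ Z) nbhd
        where
        nbhd : ∀ x → x ∈ ∁ Z → Σ[ U ∈ Subset points ] IsOpen U × x ∈ U × U ⊆ ∁ Z
        nbhd x x∈∁Z with em {Σ[ V ∈ ∣ Clop ∣ ] V ∈ F × x ∉ proj₁ V}
        ... | yes (V , V∈F , x∉V) =
          ∁ (proj₁ V) , proj₂ (proj₂ V) , ∉⇒∈∁ (proj₁ V) x∉V
          , λ y y∈∁V → ∉⇒∈∁ Z λ y∈Z → ∈∁⇒∉ (proj₁ V) y∈∁V (image≐φ⇒⊆⋂ y y∈Z V V∈F)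
        ... | no ¬∃ = ⊥-elim (∈∁⇒∉ Z x∈∁Z (image≐φ⇒⋂⊆ x λ V V∈F →
          ∉∁⇒∈ (proj₁ V) λ x∈∁V → ¬∃ (V , V∈F , ∈∁⇒∉ (proj₁ V) x∈∁V)))

    T-Clop⇒T : ∀ x y Z → T-Clop (ε ⟨$⟩ x) (image ε Z) (ε ⟨$⟩ y) → T x Z y
    T-Clop⇒T x y Z (F , F-filter , ε[Z]≐φF , D⊆εy) =
      Equivalence.from (T3 x Z y (image≐φ⇒closed F Z ε[Z]≐φF)) λ U U-clopen Z⊆U →
        ∉∁⇒∈ T[ x , U ] λ y∈∁T → absurd U U-clopen Z⊆U (∈∁⇒∉ T[ x , U ] y∈∁T)
      where
      absurd : ∀ U → IsClopen U → Z ⊆ U → ¬ (y ∉ T[ x , U ])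
      absurd U U-clopen Z⊆U y∉T
        -- Separation applies because T1 makes `T[ x , U ]` closed.
        with clopen-separation T[ x , U ] y (T1 x U (proj₂ U-clopen)) y∉T
      ... | V , T⊆V , y∉V = y∉V (D⊆εy V (dec-true em ((U , U-clopen) , U∈F , x∈U⇒V)))
        where
        U∈F : (U , U-clopen) ∈ F
        -- The intersection of `F` is `Z`, which lies in `U`, so the compactness lemma applies.
        U∈F = ⋂⊆⇒∈filter F F-filter (U , U-clopen) λ z z∈⋂F →
          Z⊆U z (image≐φ⇒⋂⊆ F Z ε[Z]≐φF z z∈⋂F)

        x∈U⇒V : x ∈ U →T proj₁ V
        x∈U⇒V = →T-intro U (proj₁ V) λ Y _ Y⊆U z Txyz →
          T⊆V z (T-monotone x z Y U U-clopen Y⊆U Txyz)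

theorem5p8 : ∀ {ℓ} (em : ExcludedMiddle ℓ) (𝔛 : Classical.ConditionalSpace em) →
    let open Classical em
        open ConditionalSpace 𝔛
        open ClopenAlgebra 𝔛 in
    IsHomeomorphism space stoneSpace ε ×
    (∀ (x y : Point) (Z : Subset points) →
      T x Z y ⇔ T-Clop (ε ⟨$⟩ x) (image ε Z) (ε ⟨$⟩ y))
theorem5p8 em 𝔛 =
  ε-homeomorphism em 𝔛 , λ x y Z → mk⇔ (T⇒T-Clop em 𝔛 x y Z) (T-Clop⇒T em 𝔛 x y Z)
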